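{- The chromatic polynomial of the Farey graph $G_n$ ($n\ge 0$) is $$P(G_n;\lambda)=\lambda(1-\lambda)(2-\lambda)^{2^n-1}.$$
   Context: The Farey graphs $G_n$ ($n\ge 0$), each with two distinguished ("special") vertices $X_n,Y_n$, are defined recursively. $G_0$ is a single edge joining its two special vertices $X_0$ and $Y_0$. For $n\ge 1$, take two disjoint copies $G_{n-1}^1,G_{n-1}^2$ of $G_{n-1}$, with special vertices $X_{n-1}^i,Y_{n-1}^i$ ($i=1,2$); identify $Y_{n-1}^1$ with $X_{n-1}^2$ into one vertex, and add a new edge $e_n$ joining $X_{n-1}^1$ and $Y_{n-1}^2$. The result is $G_n$, with special vertices $X_n=X_{n-1}^1$ and $Y_n=Y_{n-1}^2$. It has $2^n+1$ vertices and $2^{n+1}-1$ edges. The chromatic polynomial $P(G;\lambda)$ of a graph $G$ is the polynomial whose value at each positive integer $\lambda$ is the number of colorings of the vertices of $G$ with $\lambda$ colors such that adjacent vertices receive different colors.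
   Formalization: The printed formula is proved for all n ≥ 1; at n = 0 it has the wrong sign (it gives λ(1−λ), but the single edge G_0 has λ(λ−1)), so for n = 0 the corrected polynomial λ(λ−1) is proved instead. -}

module Defs where

open import Data.Nat.Base as ℕ using (ℕ; zero; suc; NonZero)
open import Data.Integer.Base as ℤ using (ℤ; +_; 0ℤ; 1ℤ)
open import Data.Fin.Base using (Fin; zero; suc; _↑ˡ_; _↑ʳ_; finToFun)
open import Data.Fin.Properties using (_≟_)
open import Data.List.Base using (List; []; _∷_; [_]; _++_; map; length; filter; allFin)
open import Data.List.Relation.Unary.All using (All; all?)
open import Data.Product.Base using (_×_; _,_)
open import Function.Base using (_∘_)
open import Relation.Binary.PropositionalEquality using (_≡_; _≢_)
open import Relation.Nullary.Decidable using (Dec; ¬?)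

-- The pair (u , v) stands for the undirected edge joining u and v.

record Graph : Set where
  field
    order : ℕ
    edges : List (Fin order × Fin order)

open Graph public

ProperColouring : (G : Graph) {k : ℕ} → (Fin (order G) → Fin k) → Set
ProperColouring G c = All (λ (u , v) → c u ≢ c v) (edges G)

properColouring? : (G : Graph) {k : ℕ} (c : Fin (order G) → Fin k) →
                   Dec (ProperColouring G c)
properColouring? G c = all? (λ (u , v) → ¬? (c u ≟ c v)) (edges G)

-- finToFun enumerates all functions Fin m → Fin k, each exactly once,
-- by the elements of Fin (k ^ m).

#colourings : Graph → ℕ → ℕ
#colourings G k =
  length (filter (properColouring? G ∘ finToFun) (allFin (k ℕ.^ order G)))

-- Univariate polynomials over ℤ as lists of coefficients, constant term first.
-- Trailing zeros are allowed, so equality of polynomials is _≈_.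

Polynomial : Set
Polynomial = List ℤ

coeff : Polynomial → ℕ → ℤ
coeff []      _       = 0ℤ
coeff (a ∷ p) zero    = a
coeff (a ∷ p) (suc i) = coeff p i

infix 4 _≈_

_≈_ : Polynomial → Polynomial → Set
p ≈ q = ∀ i → coeff p i ≡ coeff q i

eval : Polynomial → ℤ → ℤ
eval []      x = 0ℤ
eval (a ∷ p) x = a ℤ.+ x ℤ.* eval p x

infixl 6 _+_ _-_
infixl 7 _*_
infixr 8 _^_

const : ℤ → Polynomial
const a = [ a ]

-- The indeterminate (λ is reserved in Agda).
𝕩 : Polynomial
𝕩 = 0ℤ ∷ 1ℤ ∷ []

_+_ : Polynomial → Polynomial → Polynomial
[]      + q       = q
(a ∷ p) + []      = a ∷ p
(a ∷ p) + (b ∷ q) = a ℤ.+ b ∷ p + q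

_-_ : Polynomial → Polynomial → Polynomial
p - q = p + map (λ a → ℤ.- a) q

_*_ : Polynomial → Polynomial → Polynomial
[]      * q = []
(a ∷ p) * q = map (a ℤ.*_) q + (0ℤ ∷ p * q)

_^_ : Polynomial → ℕ → Polynomial
p ^ zero  = const 1ℤ
p ^ suc n = p * p ^ n

CountsColourings : Graph → Polynomial → Set
CountsColourings G p =
  ∀ (k : ℕ) → .{{NonZero k}} → eval p (+ k) ≡ + #colourings G k

-- "P is THE polynomial that counts colourings": it does so, and any
-- polynomial that does so is equal to it.

record IsChromaticPolynomial (G : Graph) (P : Polynomial) : Set where
  field
    counts : CountsColourings G P
    unique : ∀ Q → CountsColourings G Q → Q ≈ P

-- A graph with two special vertices X and Y.  The vertices are numbered so
-- that X is vertex 0.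

record SpecialGraph : Set where
  field
    others : ℕ
    Y      : Fin (suc others)
    links  : List (Fin (suc others) × Fin (suc others))

  X : Fin (suc others)
  X = zero

  graph : Graph
  graph = record { order = suc others ; edges = links }

open SpecialGraph public using (graph)

-- Two copies of H with Y of the first identified with X of the second, plus an
-- edge joining X of the first and Y of the second.  The first copy occupies
-- the first suc others vertices; the second copy contributes the remaining
-- ones, its X being the vertex that is already the first copy's Y.

module Glue (H : SpecialGraph) where
  open SpecialGraph H

  copy₁ : Fin (suc others) → Fin (suc others ℕ.+ others)
  copy₁ v = v ↑ˡ others

  copy₂ : Fin (suc others) → Fin (suc others ℕ.+ others)
  copy₂ zero    = copy₁ Y
  copy₂ (suc i) = suc others ↑ʳ i

  glued : SpecialGraph
  glued = record
    { others = others ℕ.+ others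
    ; Y      = copy₂ Y
    ; links  = (copy₁ X , copy₂ Y)
             ∷ map (λ (u , v) → copy₁ u , copy₁ v) links
            ++ map (λ (u , v) → copy₂ u , copy₂ v) links
    }

singleEdge : SpecialGraph
singleEdge = record
  { others = 1
  ; Y      = suc zero
  ; links  = [ (zero , suc zero) ]
  }

fareySpecial : ℕ → SpecialGraph
fareySpecial zero    = singleEdge
fareySpecial (suc n) = Glue.glued (fareySpecial n)

farey : ℕ → Graph
farey n = graph (fareySpecial n)

{-# OPTIONS --safe #-}

-- Over k colours, give each colouring with X ↦ a the weight f (c Y) and sum.
-- For Gₙ this gives rₙ ∑_{b ≠ a} f b: gluing composes the operators of the two
-- copies, and the new edge discards b = a, so that the k - 2 colours other than
-- a and b remain for the identified vertex and rₙ₊₁ = (k - 2) rₙ².  Summing over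
-- a with f = 1 gives k (k - 1) rₙ, and rₙ = - (2 - k)^(2ⁿ - 1) as soon as n ≥ 1.
-- Uniqueness holds because a polynomial that vanishes at all positive integers
-- has a constant term divisible by all of them; that term is 0, and dividing by
-- the indeterminate lowers the degree.

module Submission where

open import Defs
open import Data.Nat.Base as ℕ using (ℕ; zero; suc; NonZero; _∸_)
import Data.Nat.Properties as ℕ
open import Data.Nat.Divisibility using (divides; >⇒∤)
open import Data.Integer.Base as ℤ using (ℤ; +_; 0ℤ; 1ℤ; ∣_∣)
import Data.Integer.Properties as ℤ
open import Data.Integer.Tactic.RingSolver using (solve-∀)
open import Algebra.Properties.Semiring.Sum ℤ.+-*-semiring
open import Data.Bool.Base using (true; false; if_then_else_)
open import Data.Fin.Base using (Fin; zero; suc; _↑ˡ_; _↑ʳ_; combine; finToFun)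
open import Data.Fin.Properties using (_≟_; remQuot-combine)
open import Data.List.Base using ([]; _∷_; map; length; filter; tabulate)
open import Data.List.Relation.Unary.All as All using ([]; _∷_)
open import Data.List.Relation.Unary.All.Properties using (map⁺; map⁻; ++⁺; ++⁻)
open import Data.Product.Base using (_×_; _,_; proj₁; proj₂)
open import Data.Sum.Base using (inj₂)
open import Data.Unit.Base using (tt)
open import Data.Vec.Base as Vec using (Vec; []; _∷_; lookup)
open import Data.Vec.Properties using (lookup-++ˡ; lookup-++ʳ)
import Data.Vec.Functional as F
open import Function.Base using (_∘_)
open import Function.Bundles using (_⇔_; mk⇔)
open import Relation.Binary.PropositionalEquality
open import Relation.Nullary.Decidable using (Dec; does; yes; ¬?; _×-dec_; does-⇔)
open import Relation.Nullary.Negation using (contradiction)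
open import Relation.Unary using (Decidable)

open ≡-Reasoning

private variable
  k m n : ℕ

-- Polynomials

eval-+ : ∀ p q x → eval (p + q) x ≡ eval p x ℤ.+ eval q x
eval-+ []      q       x = sym (ℤ.+-identityˡ _)
eval-+ (a ∷ p) []      x = sym (ℤ.+-identityʳ _)
eval-+ (a ∷ p) (b ∷ q) x rewrite eval-+ p q x =
  rearrange a b x (eval p x) (eval q x)
  where
  rearrange : ∀ a b x y z → a ℤ.+ b ℤ.+ x ℤ.* (y ℤ.+ z) ≡ (a ℤ.+ x ℤ.* y) ℤ.+ (b ℤ.+ x ℤ.* z)
  rearrange = solve-∀

eval-neg : ∀ p x → eval (map (λ a → ℤ.- a) p) x ≡ ℤ.- eval p x
eval-neg []      x = refl
eval-neg (a ∷ p) x rewrite eval-neg p x = rearrange a x (eval p x)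
  where
  rearrange : ∀ a x y → ℤ.- a ℤ.+ x ℤ.* (ℤ.- y) ≡ ℤ.- (a ℤ.+ x ℤ.* y)
  rearrange = solve-∀

eval-minus : ∀ p q x → eval (p - q) x ≡ eval p x ℤ.- eval q x
eval-minus p q x = trans (eval-+ p _ x) (cong (λ y → eval p x ℤ.+ y) (eval-neg q x))

eval-scale : ∀ a p x → eval (map (a ℤ.*_) p) x ≡ a ℤ.* eval p x
eval-scale a []      x = sym (ℤ.*-zeroʳ a)
eval-scale a (b ∷ p) x rewrite eval-scale a p x = rearrange a b x (eval p x)
  where
  rearrange : ∀ a b x y → a ℤ.* b ℤ.+ x ℤ.* (a ℤ.* y) ≡ a ℤ.* (b ℤ.+ x ℤ.* y)
  rearrange = solve-∀

eval-* : ∀ p q x → eval (p * q) x ≡ eval p x ℤ.* eval q x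
eval-* []      q x = refl
eval-* (a ∷ p) q x
  rewrite eval-+ (map (a ℤ.*_) q) (0ℤ ∷ p * q) x | eval-scale a q x | eval-* p q x =
  rearrange a x (eval p x) (eval q x)
  where
  rearrange : ∀ a x y z → a ℤ.* z ℤ.+ (0ℤ ℤ.+ x ℤ.* (y ℤ.* z)) ≡ (a ℤ.+ x ℤ.* y) ℤ.* z
  rearrange = solve-∀

eval-const : ∀ a x → eval (const a) x ≡ a
eval-const a x = trans (cong (λ y → a ℤ.+ y) (ℤ.*-zeroʳ x)) (ℤ.+-identityʳ a)

eval-𝕩 : ∀ x → eval 𝕩 x ≡ x
eval-𝕩 x = rearrange x
  where
  rearrange : ∀ x → 0ℤ ℤ.+ x ℤ.* (1ℤ ℤ.+ x ℤ.* 0ℤ) ≡ x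
  rearrange = solve-∀

eval-^ : ∀ p n x → eval (p ^ n) x ≡ eval p x ℤ.^ n
eval-^ p zero    x = eval-const 1ℤ x
eval-^ p (suc n) x = trans (eval-* p (p ^ n) x) (cong (eval p x ℤ.*_) (eval-^ p n x))

coeff-+ : ∀ p q i → coeff (p + q) i ≡ coeff p i ℤ.+ coeff q i
coeff-+ []      q       i       = sym (ℤ.+-identityˡ _)
coeff-+ (a ∷ p) []      i       = sym (ℤ.+-identityʳ _)
coeff-+ (a ∷ p) (b ∷ q) zero    = refl
coeff-+ (a ∷ p) (b ∷ q) (suc i) = coeff-+ p q i

coeff-neg : ∀ p i → coeff (map (λ a → ℤ.- a) p) i ≡ ℤ.- coeff p i
coeff-neg []      i       = refl
coeff-neg (a ∷ p) zero    = refl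
coeff-neg (a ∷ p) (suc i) = coeff-neg p i

-- Polynomials determined by their values at the positive integers

VanishesOnPositives : Polynomial → Set
VanishesOnPositives p = ∀ k → eval p (+ suc k) ≡ 0ℤ

-- A single evaluation suffices: at `suc ∣ a ∣` the vanishing makes this number divide `∣ a ∣`,
-- which is smaller and hence zero.
constant-term≡0 : ∀ a p → VanishesOnPositives (a ∷ p) → a ≡ 0ℤ
constant-term≡0 a p vanishes = ℤ.∣i∣≡0⇒i≡0 (≡0 ∣ a ∣ ∣ e ∣ divisible)
  where
  e = eval p (+ suc ∣ a ∣)

  a--xe≡0 : a ℤ.- ℤ.- (+ suc ∣ a ∣ ℤ.* e) ≡ 0ℤ
  a--xe≡0 = trans (cong (λ b → a ℤ.+ b) (ℤ.neg-involutive _)) (vanishes ∣ a ∣)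

  divisible : ∣ a ∣ ≡ ∣ e ∣ ℕ.* suc ∣ a ∣
  divisible = begin
    ∣ a ∣                        ≡⟨ cong ∣_∣ (ℤ.i-j≡0⇒i≡j a _ a--xe≡0) ⟩
    ∣ ℤ.- (+ suc ∣ a ∣ ℤ.* e) ∣  ≡⟨ ℤ.∣-i∣≡∣i∣ (+ suc ∣ a ∣ ℤ.* e) ⟩
    ∣ + suc ∣ a ∣ ℤ.* e ∣        ≡⟨ ℤ.abs-* (+ suc ∣ a ∣) e ⟩
    suc ∣ a ∣ ℕ.* ∣ e ∣          ≡⟨ ℕ.*-comm (suc ∣ a ∣) ∣ e ∣ ⟩
    ∣ e ∣ ℕ.* suc ∣ a ∣          ∎

  ≡0 : ∀ n q → n ≡ q ℕ.* suc n → n ≡ 0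
  ≡0 zero    q eq = refl
  ≡0 (suc n) q eq = contradiction (divides q eq) (>⇒∤ ℕ.≤-refl)

vanishing⇒≈0 : ∀ p → VanishesOnPositives p → p ≈ []
vanishing⇒≈0 []      vanishes i       = refl
vanishing⇒≈0 (a ∷ p) vanishes zero    = constant-term≡0 a p vanishes
vanishing⇒≈0 (a ∷ p) vanishes (suc i) = vanishing⇒≈0 p tail-vanishes i
  where
  tail-vanishes : VanishesOnPositives p
  -- ℤ has no zero divisors and `+ suc k` is nonzero, so only the second alternative remains. This
  -- is why vanishing is asked at positive arguments only.
  tail-vanishes k with ℤ.i*j≡0⇒i≡0∨j≡0 (+ suc k) product≡0
    where
    product≡0 : + suc k ℤ.* eval p (+ suc k) ≡ 0ℤ
    product≡0 = begin
      x        ≡⟨ ℤ.+-identityˡ x ⟨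
      0ℤ ℤ.+ x ≡⟨ cong (ℤ._+ x) (constant-term≡0 a p vanishes) ⟨
      a ℤ.+ x  ≡⟨ vanishes k ⟩
      0ℤ       ∎
      where x = + suc k ℤ.* eval p (+ suc k)
  ... | inj₂ eval≡0 = eval≡0

agreeOnPositives⇒≈ : ∀ p q → (∀ k → eval p (+ suc k) ≡ eval q (+ suc k)) → p ≈ q
agreeOnPositives⇒≈ p q agree i = ℤ.i-j≡0⇒i≡j (coeff p i) (coeff q i) (begin
  coeff p i ℤ.- coeff q i                  ≡⟨ cong (λ b → coeff p i ℤ.+ b) (coeff-neg q i) ⟨
  coeff p i ℤ.+ coeff (map (λ a → ℤ.- a) q) i ≡⟨ coeff-+ p _ i ⟨
  coeff (p - q) i                          ≡⟨ vanishing⇒≈0 (p - q) vanishes i ⟩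
  0ℤ                                       ∎)
  where
  vanishes : VanishesOnPositives (p - q)
  vanishes k = trans (eval-minus p q _) (ℤ.i≡j⇒i-j≡0 (agree k))

counts⇒chromatic : ∀ {G P} → CountsColourings G P → IsChromaticPolynomial G P
counts⇒chromatic {P = P} counts = record
  { counts = counts
  ; unique = λ Q countsQ →
      agreeOnPositives⇒≈ Q P λ k → trans (countsQ (suc k)) (sym (counts (suc k)))
  }

-- Indicators and finite sums

⟦_⟧ : ∀ {a} {A : Set a} → Dec A → ℤ
⟦ a? ⟧ = if does a? then 1ℤ else 0ℤ

⟦⟧-cong : ∀ {a b} {A : Set a} {B : Set b} → A ⇔ B →
          (a? : Dec A) (b? : Dec B) → ⟦ a? ⟧ ≡ ⟦ b? ⟧
⟦⟧-cong A⇔B a? b? = cong (λ b → if b then 1ℤ else 0ℤ) (does-⇔ A⇔B a? b?)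

⟦⟧-× : ∀ {a b} {A : Set a} {B : Set b} (a? : Dec A) (b? : Dec B) →
       ⟦ a? ×-dec b? ⟧ ≡ ⟦ a? ⟧ ℤ.* ⟦ b? ⟧
⟦⟧-× a? b? with does a?
... | true  = sym (ℤ.*-identityˡ _)
... | false = refl

-- A general `f` instead of `allFin` lets the induction pass to `f ∘ suc`.
length-filter-tabulate : ∀ {A : Set} {P : A → Set} (P? : Decidable P) (f : Fin n → A) →
                         + length (filter P? (tabulate f)) ≡ ∑[ i < n ] ⟦ P? (f i) ⟧
length-filter-tabulate {zero}  P? f = refl
length-filter-tabulate {suc n} P? f with does (P? (f zero))
... | true  = cong ℤ.suc (length-filter-tabulate P? (f ∘ suc))
... | false = trans (length-filter-tabulate P? (f ∘ suc)) (sym (ℤ.+-identityˡ _))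

sum-const : ∀ k x → ∑[ i < k ] x ≡ + k ℤ.* x
sum-const zero    x = refl
sum-const (suc k) x = trans (cong (λ y → x ℤ.+ y) (sum-const k x)) (sym (ℤ.suc-* (+ k) x))

sum-const-minus : ∀ x (f : Fin k → ℤ) → ∑[ i < k ] (x ℤ.- f i) ≡ + k ℤ.* x ℤ.- sum f
sum-const-minus {zero}  x f = refl
sum-const-minus {suc k} x f
  rewrite sum-const-minus x (f ∘ suc) | ℤ.suc-* (+ k) x =
  rearrange x (f zero) (+ k ℤ.* x) (sum (f ∘ suc))
  where
  rearrange : ∀ x y z w → (x ℤ.- y) ℤ.+ (z ℤ.- w) ≡ (x ℤ.+ z) ℤ.- (y ℤ.+ w)
  rearrange = solve-∀

sum-↑ : ∀ m (f : Fin (m ℕ.+ n) → ℤ) →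
        sum f ≡ sum (f ∘ (_↑ˡ n)) ℤ.+ sum (f ∘ (m ↑ʳ_))
sum-↑ zero    f = sym (ℤ.+-identityˡ _)
sum-↑ (suc m) f = trans
  (cong (λ y → f zero ℤ.+ y) (sum-↑ m (f ∘ suc)))
  (sym (ℤ.+-assoc (f zero) _ _))

sum-combine : ∀ m (f : Fin (m ℕ.* n) → ℤ) →
              sum f ≡ ∑[ i < m ] ∑[ j < n ] f (combine i j)
sum-combine         zero    f = refl
sum-combine {n = n} (suc m) f = trans
  (sum-↑ n f)
  (cong (λ y → sum (f ∘ (_↑ˡ (m ℕ.* n))) ℤ.+ y) (sum-combine m (f ∘ (n ↑ʳ_))))

-- Colourings are summed as vectors because a sum over concatenations then splits by recursion,
-- which is what gluing needs.
sumVec : ∀ n → (Vec (Fin k) n → ℤ) → ℤ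
sumVec     zero    f = f []
sumVec {k} (suc n) f = ∑[ a < k ] sumVec n (f ∘ (a ∷_))

sumVec-cong : ∀ n {f g : Vec (Fin k) n → ℤ} → f ≗ g → sumVec n f ≡ sumVec n g
sumVec-cong zero    f≗g = f≗g []
sumVec-cong (suc n) f≗g = sum-cong-≗ λ a → sumVec-cong n (f≗g ∘ (a ∷_))

sumVec-*ˡ : ∀ n x (f : Vec (Fin k) n → ℤ) → sumVec n (λ v → x ℤ.* f v) ≡ x ℤ.* sumVec n f
sumVec-*ˡ zero    x f = refl
sumVec-*ˡ {k} (suc n) x f = trans
  (sum-cong-≗ λ a → sumVec-*ˡ n x (f ∘ (a ∷_)))
  (sym (*-distribˡ-sum {n = k} x _))

sumVec-++ : ∀ m (f : Vec (Fin k) (m ℕ.+ n) → ℤ) →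
            sumVec (m ℕ.+ n) f ≡ sumVec m λ u → sumVec n λ v → f (u Vec.++ v)
sumVec-++ zero    f = refl
sumVec-++ (suc m) f = sum-cong-≗ λ a → sumVec-++ m (f ∘ (a ∷_))

-- The leading base-`k` digit of an index is the value at `zero`, so the enumeration splits into a
-- sum over that value and a sum over the rest. That `f` respects `≗` replaces function
-- extensionality.
sum-finToFun : ∀ n (f : (Fin n → Fin k) → ℤ) → (∀ {c d} → c ≗ d → f c ≡ f d) →
               sum (f ∘ finToFun) ≡ sumVec n (f ∘ lookup)
sum-finToFun         zero    f f-cong = trans (ℤ.+-identityʳ _) (f-cong λ ())
sum-finToFun {k = k} (suc n) f f-cong = begin
  sum (f ∘ finToFun)
    ≡⟨ sum-combine k (f ∘ finToFun) ⟩
  ∑[ a < k ] ∑[ j < k ℕ.^ n ] f (finToFun (combine a j))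
    ≡⟨ (sum-cong-≗ λ a → sum-cong-≗ λ j → f-cong (finToFun-combine a j)) ⟩
  ∑[ a < k ] ∑[ j < k ℕ.^ n ] f (a F.∷ finToFun j)
    ≡⟨ (sum-cong-≗ λ a → sum-finToFun n (f ∘ (a F.∷_)) (f-cong ∘ ∷-cong a)) ⟩
  ∑[ a < k ] sumVec n (λ v → f (a F.∷ lookup v))
    ≡⟨ (sum-cong-≗ λ a → sumVec-cong n λ v → f-cong (∷-lookup a v)) ⟩
  sumVec (suc n) (f ∘ lookup) ∎
  where
  finToFun-combine : ∀ a j → finToFun {n = suc n} (combine a j) ≗ a F.∷ finToFun j
  finToFun-combine a j zero    = cong proj₁ (remQuot-combine a j)
  finToFun-combine a j (suc i) = cong (λ p → finToFun (proj₂ p) i) (remQuot-combine {k} a j)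

  ∷-cong : ∀ a {c d : Fin n → Fin k} → c ≗ d → a F.∷ c ≗ a F.∷ d
  ∷-cong a c≗d zero    = refl
  ∷-cong a c≗d (suc i) = c≗d i

  ∷-lookup : ∀ a v → a F.∷ lookup v ≗ lookup (a ∷ v)
  ∷-lookup a v zero    = refl
  ∷-lookup a v (suc i) = refl

-- Colourings

proper : (G : Graph) → (Fin (order G) → Fin k) → ℤ
proper G c = ⟦ properColouring? G c ⟧

ProperColouring-resp-≗ : ∀ G {c d : Fin (order G) → Fin k} → c ≗ d →
                         ProperColouring G c → ProperColouring G d
ProperColouring-resp-≗ G c≗d = All.map λ {(u , v)} → subst₂ _≢_ (c≗d u) (c≗d v)

#colourings-sumVec : ∀ G k → + #colourings G k ≡ sumVec {k} (order G) (proper G ∘ lookup)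
#colourings-sumVec G k = trans
  (length-filter-tabulate {n = k ℕ.^ order G} (properColouring? G ∘ finToFun) (λ i → i))
  (sum-finToFun (order G) (proper G) λ {c} {d} c≗d → ⟦⟧-cong
    (mk⇔ (ProperColouring-resp-≗ G c≗d) (ProperColouring-resp-≗ G (sym ∘ c≗d)))
    (properColouring? G c) (properColouring? G d))

distinct : Fin k → Fin k → ℤ
distinct a b = ⟦ ¬? (a ≟ b) ⟧

distinct-refl : (a : Fin k) → distinct a a ≡ 0ℤ
distinct-refl zero    = refl
distinct-refl (suc a) = distinct-refl a

sum-distinct : ∀ a (f : Fin k → ℤ) → ∑[ b < k ] (distinct a b ℤ.* f b) ≡ sum f ℤ.- f a
sum-distinct zero    f = trans
  (cong (λ y → 0ℤ ℤ.* f zero ℤ.+ y) (sum-cong-≗ λ b → ℤ.*-identityˡ (f (suc b))))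
  (rearrange (f zero) (sum (f ∘ suc)))
  where
  rearrange : ∀ x y → 0ℤ ℤ.* x ℤ.+ y ≡ x ℤ.+ y ℤ.- x
  rearrange = solve-∀
sum-distinct (suc a) f rewrite sum-distinct a (f ∘ suc) =
  rearrange (f zero) (sum (f ∘ suc)) (f (suc a))
  where
  rearrange : ∀ x y z → 1ℤ ℤ.* x ℤ.+ (y ℤ.- z) ≡ x ℤ.+ y ℤ.- z
  rearrange = solve-∀

-- The transfer operator of a graph with two special vertices

module _ (H : SpecialGraph) where
  open SpecialGraph H using (others; Y)

  transfer : Fin k → (Fin k → ℤ) → ℤ
  transfer a f = sumVec others λ v →
    proper (graph H) (lookup (a ∷ v)) ℤ.* f (lookup (a ∷ v) Y)

  -- As a matrix indexed by colours, the operator is r(J - I) with J the all-ones matrix: r proper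
  -- colourings extend each choice of distinct colours at X and Y, and none extends equal ones.
  TransfersBy : ℕ → ℤ → Set
  TransfersBy k r = ∀ a (f : Fin k → ℤ) →
    transfer a f ≡ r ℤ.* ∑[ b < k ] (distinct a b ℤ.* f b)

  #colourings-transfer : ∀ r → TransfersBy k r →
                         + #colourings (graph H) k ≡ + k ℤ.* (+ k ℤ.- 1ℤ) ℤ.* r
  #colourings-transfer {k} r transfers = begin
    + #colourings (graph H) k
      ≡⟨ #colourings-sumVec (graph H) k ⟩
    ∑[ a < k ] sumVec others (λ v → proper (graph H) (lookup (a ∷ v)))
      ≡⟨ (sum-cong-≗ {n = k} λ a → sumVec-cong others λ v → sym (ℤ.*-identityʳ _)) ⟩
    ∑[ a < k ] transfer a (λ _ → 1ℤ)
      ≡⟨ (sum-cong-≗ λ a → trans (transfers a _) (cong (r ℤ.*_) (sum-distinct a _))) ⟩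
    ∑[ a < k ] (r ℤ.* (∑[ b < k ] 1ℤ ℤ.- 1ℤ))
      ≡⟨ sum-const k _ ⟩
    + k ℤ.* (r ℤ.* (∑[ b < k ] 1ℤ ℤ.- 1ℤ))
      ≡⟨ cong (λ s → + k ℤ.* (r ℤ.* (s ℤ.- 1ℤ))) (sum-const k 1ℤ) ⟩
    + k ℤ.* (r ℤ.* (+ k ℤ.* 1ℤ ℤ.- 1ℤ))
      ≡⟨ rearrange (+ k) r ⟩
    + k ℤ.* (+ k ℤ.- 1ℤ) ℤ.* r ∎
    where
    rearrange : ∀ k r → k ℤ.* (r ℤ.* (k ℤ.* 1ℤ ℤ.- 1ℤ)) ≡ k ℤ.* (k ℤ.- 1ℤ) ℤ.* r
    rearrange = solve-∀

-- Gluing as composition of transfer operators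

module _ (H : SpecialGraph) where
  open SpecialGraph H using (others; Y; links)
  open Glue H

  module _ (a : Fin k) (u v : Vec (Fin k) others) where
    c₁ c₂ : Fin (suc others) → Fin k
    c₁ = lookup (a ∷ u)
    -- X of the second copy is Y of the first and takes its colour from there; `v` colours only the
    -- new vertices.
    c₂ = lookup (c₁ Y ∷ v)

    c : Fin (suc others ℕ.+ others) → Fin k
    c = lookup (a ∷ u Vec.++ v)

    c∘copy₁ : c ∘ copy₁ ≗ c₁
    c∘copy₁ = lookup-++ˡ (a ∷ u) v

    c∘copy₂ : c ∘ copy₂ ≗ c₂
    c∘copy₂ zero    = c∘copy₁ Y
    c∘copy₂ (suc i) = lookup-++ʳ (a ∷ u) v i

    proper-glued : proper (graph glued) c ≡
                   distinct a (c₂ Y) ℤ.* (proper (graph H) c₁ ℤ.* proper (graph H) c₂)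
    proper-glued = begin
      proper (graph glued) c
        ≡⟨ ⟦⟧-cong (mk⇔ split join) (properColouring? (graph glued) c) (¬? (a ≟ c₂ Y) ×-dec (p₁ ×-dec p₂)) ⟩
      ⟦ ¬? (a ≟ c₂ Y) ×-dec (p₁ ×-dec p₂) ⟧
        ≡⟨ ⟦⟧-× (¬? (a ≟ c₂ Y)) (p₁ ×-dec p₂) ⟩
      distinct a (c₂ Y) ℤ.* ⟦ p₁ ×-dec p₂ ⟧
        ≡⟨ cong (distinct a (c₂ Y) ℤ.*_) (⟦⟧-× p₁ p₂) ⟩
      distinct a (c₂ Y) ℤ.* (⟦ p₁ ⟧ ℤ.* ⟦ p₂ ⟧) ∎
      where
      p₁ = properColouring? (graph H) c₁
      p₂ = properColouring? (graph H) c₂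

      split : ProperColouring (graph glued) c →
              a ≢ c₂ Y × ProperColouring (graph H) c₁ × ProperColouring (graph H) c₂
      split (a≢ ∷ ps) with ++⁻ (map (λ (u , v) → copy₁ u , copy₁ v) links) ps
      -- The new edge starts at vertex `zero`, whose colour reduces to `a`, so only its other end
      -- needs transport.
      ... | ps₁ , ps₂ = subst (a ≢_) (c∘copy₂ Y) a≢
                      , ProperColouring-resp-≗ (graph H) c∘copy₁ (map⁻ ps₁)
                      , ProperColouring-resp-≗ (graph H) c∘copy₂ (map⁻ ps₂)

      join : a ≢ c₂ Y × ProperColouring (graph H) c₁ × ProperColouring (graph H) c₂ →
             ProperColouring (graph glued) c
      join (a≢ , ps₁ , ps₂) = subst (a ≢_) (sym (c∘copy₂ Y)) a≢ ∷ ++⁺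
        (map⁺ (ProperColouring-resp-≗ (graph H) (sym ∘ c∘copy₁) ps₁))
        (map⁺ (ProperColouring-resp-≗ (graph H) (sym ∘ c∘copy₂) ps₂))

  -- Once `u` is fixed, the second copy depends on it only through the colour b of the identified
  -- vertex, so the inner sum is a transfer from b. The indicator of the new edge is absorbed into
  -- the weight.
  transfer-glued : ∀ a (f : Fin k → ℤ) →
    transfer glued a f ≡ transfer H a λ b → transfer H b λ y → distinct a y ℤ.* f y
  transfer-glued a f = trans (sumVec-++ others _) (sumVec-cong others λ u → trans
    (sumVec-cong others λ v → begin
      proper (graph glued) (c a u v) ℤ.* f (c a u v (copy₂ Y))
        ≡⟨ cong₂ (λ p y → p ℤ.* f y) (proper-glued a u v) (c∘copy₂ a u v Y) ⟩
      distinct a (c₂ a u v Y) ℤ.* (proper (graph H) (c₁ a u v) ℤ.* proper (graph H) (c₂ a u v))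
        ℤ.* f (c₂ a u v Y)
        ≡⟨ rearrange (distinct a (c₂ a u v Y)) (proper (graph H) (c₁ a u v)) _ _ ⟩
      proper (graph H) (c₁ a u v) ℤ.*
        (proper (graph H) (c₂ a u v) ℤ.* (distinct a (c₂ a u v Y) ℤ.* f (c₂ a u v Y))) ∎)
    -- The factor of the first copy does not depend on `v` and leaves the inner sum.
    (sumVec-*ˡ others (proper (graph H) (lookup (a ∷ u))) _))
    where
    rearrange : ∀ d p q y → d ℤ.* (p ℤ.* q) ℤ.* y ≡ p ℤ.* (q ℤ.* (d ℤ.* y))
    rearrange = solve-∀

  -- (J - I)² = (k - 2)J + I. The new edge replaces `f` by `g`, which vanishes at `a`, so the
  -- summand I contributes nothing, and J applied to `g` is again the sum of `f` over the colours
  -- other than `a`.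
  transfersBy-glued : ∀ r → TransfersBy H k r →
                      TransfersBy glued k ((+ k ℤ.- + 2) ℤ.* (r ℤ.* r))
  transfersBy-glued {k} r transfers a f = begin
    transfer glued a f
      ≡⟨ transfer-glued a f ⟩
    transfer H a (λ b → transfer H b g)
      ≡⟨ transfers a _ ⟩
    r ℤ.* ∑[ b < k ] (distinct a b ℤ.* transfer H b g)
      ≡⟨ cong (r ℤ.*_) (sum-distinct a _) ⟩
    r ℤ.* (∑[ b < k ] transfer H b g ℤ.- transfer H a g)
      ≡⟨ cong (r ℤ.*_) (cong₂ ℤ._-_ (sum-cong-≗ transfer-g) (transfer-g a)) ⟩
    r ℤ.* (∑[ b < k ] (r ℤ.* (sum g ℤ.- g b)) ℤ.- r ℤ.* (sum g ℤ.- g a))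
      ≡⟨ cong (λ s → r ℤ.* (s ℤ.- r ℤ.* (sum g ℤ.- g a))) (*-distribˡ-sum {n = k} r _) ⟨
    r ℤ.* (r ℤ.* ∑[ b < k ] (sum g ℤ.- g b) ℤ.- r ℤ.* (sum g ℤ.- g a))
      ≡⟨ cong₂ (λ s y → r ℤ.* (r ℤ.* s ℤ.- r ℤ.* (sum g ℤ.- y))) (sum-const-minus (sum g) g) g[a]≡0 ⟩
    r ℤ.* (r ℤ.* (+ k ℤ.* sum g ℤ.- sum g) ℤ.- r ℤ.* (sum g ℤ.- 0ℤ))
      ≡⟨ rearrange (+ k) r (sum g) ⟩
    (+ k ℤ.- + 2) ℤ.* (r ℤ.* r) ℤ.* sum g ∎
    where
    g : Fin k → ℤ
    g b = distinct a b ℤ.* f b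

    g[a]≡0 : g a ≡ 0ℤ
    g[a]≡0 = cong (ℤ._* f a) (distinct-refl a)

    transfer-g : ∀ b → transfer H b g ≡ r ℤ.* (sum g ℤ.- g b)
    transfer-g b = trans (transfers b g) (cong (r ℤ.*_) (sum-distinct b g))

    rearrange : ∀ k r s → r ℤ.* (r ℤ.* (k ℤ.* s ℤ.- s) ℤ.- r ℤ.* (s ℤ.- 0ℤ)) ≡
                          (k ℤ.- + 2) ℤ.* (r ℤ.* r) ℤ.* s
    rearrange = solve-∀

-- The Farey graphs: recurrence and closed form

transferFactor : ℤ → ℕ → ℤ
transferFactor x zero    = 1ℤ
transferFactor x (suc n) = (x ℤ.- + 2) ℤ.* (transferFactor x n ℤ.* transferFactor x n)

transfersBy-farey : ∀ n → TransfersBy (fareySpecial n) k (transferFactor (+ k) n)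
transfersBy-farey {k} zero a f = trans
  -- `⟦_⟧` sees only Booleans, so `yes tt` can stand for the decision on the empty list that follows
  -- the only edge.
  (sum-cong-≗ {n = k} λ b → cong (ℤ._* f b) (trans (⟦⟧-× (¬? (a ≟ b)) (yes tt)) (ℤ.*-identityʳ (distinct a b))))
  (sym (ℤ.*-identityˡ _))
transfersBy-farey (suc n) =
  transfersBy-glued (fareySpecial n) (transferFactor _ n) (transfersBy-farey n)

#colourings-farey : ∀ n k → + #colourings (farey n) k ≡
                    + k ℤ.* (+ k ℤ.- 1ℤ) ℤ.* transferFactor (+ k) n
#colourings-farey n k =
  #colourings-transfer (fareySpecial n) (transferFactor (+ k) n) (transfersBy-farey n)

2^[1+n]∸1 : ∀ n → 2 ℕ.^ suc n ∸ 1 ≡ suc ((2 ℕ.^ n ∸ 1) ℕ.+ (2 ℕ.^ n ∸ 1))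
-- Positivity excludes zero, where truncated subtraction would falsify the identity.
2^[1+n]∸1 n with 2 ℕ.^ n | ℕ.m^n>0 2 n
... | suc m | _ = trans (cong (m ℕ.+_) (ℕ.+-identityʳ (suc m))) (ℕ.+-suc m m)

-- The index starts at one because the factor of the single edge is 1, not -1. Squaring removes any
-- sign and x - 2 = -(2 - x) brings in one minus, so the sign is constant from then on, while the
-- exponent e becomes 2e + 1.
transferFactor-power : ∀ x n → transferFactor x (suc n) ≡ ℤ.- ((+ 2 ℤ.- x) ℤ.^ (2 ℕ.^ suc n ∸ 1))
transferFactor-power x zero = rearrange x
  where
  rearrange : ∀ x → (x ℤ.- + 2) ℤ.* (1ℤ ℤ.* 1ℤ) ≡ ℤ.- ((+ 2 ℤ.- x) ℤ.* 1ℤ)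
  rearrange = solve-∀
transferFactor-power x (suc n) = begin
  (x ℤ.- + 2) ℤ.* (transferFactor x (suc n) ℤ.* transferFactor x (suc n))
    ≡⟨ cong (λ r → (x ℤ.- + 2) ℤ.* (r ℤ.* r)) (transferFactor-power x n) ⟩
  (x ℤ.- + 2) ℤ.* (ℤ.- (y ℤ.^ e) ℤ.* ℤ.- (y ℤ.^ e))
    ≡⟨ rearrange x (y ℤ.^ e) ⟩
  ℤ.- (y ℤ.* (y ℤ.^ e ℤ.* y ℤ.^ e))
    ≡⟨ cong (λ z → ℤ.- (y ℤ.* z)) (ℤ.^-distribˡ-+-* y e e) ⟨
  ℤ.- (y ℤ.^ suc (e ℕ.+ e))
    ≡⟨ cong (λ i → ℤ.- (y ℤ.^ i)) (2^[1+n]∸1 (suc n)) ⟨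
  ℤ.- (y ℤ.^ (2 ℕ.^ suc (suc n) ∸ 1)) ∎
  where
  y = + 2 ℤ.- x
  e = 2 ℕ.^ suc n ∸ 1

  rearrange : ∀ x s → (x ℤ.- + 2) ℤ.* (ℤ.- s ℤ.* ℤ.- s) ≡ ℤ.- ((+ 2 ℤ.- x) ℤ.* (s ℤ.* s))
  rearrange = solve-∀

eval-const-minus-𝕩 : ∀ a x → eval (const a - 𝕩) x ≡ a ℤ.- x
eval-const-minus-𝕩 a x = trans (eval-minus (const a) 𝕩 x) (cong₂ ℤ._-_ (eval-const a x) (eval-𝕩 x))

farey-counts : ∀ n → CountsColourings (farey (suc n))
  (𝕩 * (const (+ 1) - 𝕩) * (const (+ 2) - 𝕩) ^ (2 ℕ.^ suc n ∸ 1))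
farey-counts n k = begin
  eval (𝕩 * (const (+ 1) - 𝕩) * (const (+ 2) - 𝕩) ^ e) x
    ≡⟨ eval-* (𝕩 * (const (+ 1) - 𝕩)) ((const (+ 2) - 𝕩) ^ e) x ⟩
  eval (𝕩 * (const (+ 1) - 𝕩)) x ℤ.* eval ((const (+ 2) - 𝕩) ^ e) x
    ≡⟨ cong₂ ℤ._*_ (eval-* 𝕩 (const (+ 1) - 𝕩) x) (eval-^ (const (+ 2) - 𝕩) e x) ⟩
  eval 𝕩 x ℤ.* eval (const (+ 1) - 𝕩) x ℤ.* eval (const (+ 2) - 𝕩) x ℤ.^ e
    ≡⟨ cong₂ ℤ._*_ (cong₂ ℤ._*_ (eval-𝕩 x) (eval-const-minus-𝕩 (+ 1) x))
                   (cong (ℤ._^ e) (eval-const-minus-𝕩 (+ 2) x)) ⟩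
  x ℤ.* (1ℤ ℤ.- x) ℤ.* (+ 2 ℤ.- x) ℤ.^ e
    -- The sign of 1 - x moves to the power, where it matches the sign of the transfer factor.
    ≡⟨ rearrange x _ ⟩
  x ℤ.* (x ℤ.- 1ℤ) ℤ.* ℤ.- ((+ 2 ℤ.- x) ℤ.^ e)
    ≡⟨ cong (x ℤ.* (x ℤ.- 1ℤ) ℤ.*_) (transferFactor-power x n) ⟨
  x ℤ.* (x ℤ.- 1ℤ) ℤ.* transferFactor x (suc n)
    ≡⟨ #colourings-farey (suc n) k ⟨
  + #colourings (farey (suc n)) k ∎
  where
  x = + k
  e = 2 ℕ.^ suc n ∸ 1

  rearrange : ∀ x s → x ℤ.* (1ℤ ℤ.- x) ℤ.* s ≡ x ℤ.* (x ℤ.- 1ℤ) ℤ.* ℤ.- s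
  rearrange = solve-∀

edge-counts : CountsColourings (farey 0) (𝕩 * (𝕩 - const (+ 1)))
edge-counts k = begin
  eval (𝕩 * (𝕩 - const (+ 1))) x
    ≡⟨ eval-* 𝕩 (𝕩 - const (+ 1)) x ⟩
  eval 𝕩 x ℤ.* eval (𝕩 - const (+ 1)) x
    ≡⟨ cong (eval 𝕩 x ℤ.*_) (eval-minus 𝕩 (const (+ 1)) x) ⟩
  eval 𝕩 x ℤ.* (eval 𝕩 x ℤ.- eval (const (+ 1)) x)
    ≡⟨ cong₂ (λ y z → y ℤ.* (y ℤ.- z)) (eval-𝕩 x) (eval-const 1ℤ x) ⟩
  x ℤ.* (x ℤ.- 1ℤ)
    ≡⟨ ℤ.*-identityʳ _ ⟨
  x ℤ.* (x ℤ.- 1ℤ) ℤ.* 1ℤ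
    ≡⟨ #colourings-farey 0 k ⟨
  + #colourings (farey 0) k ∎
  where x = + k

-- The closed formula is asserted for n ≥ 1. At n = 0 its exponent is 0 and it would give λ(1 - λ),
-- the negative of the chromatic polynomial λ(λ - 1) of an edge, so that case is stated with its
-- correct sign.
mainTheorem6 : (∀ (n : ℕ) → .{{NonZero n}} →
    IsChromaticPolynomial (farey n)
    (𝕩 * (const (+ 1) - 𝕩) * (const (+ 2) - 𝕩) ^ (2 ℕ.^ n ∸ 1)))
    × IsChromaticPolynomial (farey 0) (𝕩 * (𝕩 - const (+ 1)))
mainTheorem6 = (λ { (suc n) → counts⇒chromatic (farey-counts n) }) , counts⇒chromatic edge-counts
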